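{- Let $\alpha$ be a positive integer. Every graph $G$ with chromatic number at most $\alpha$ admits a partial edge colouring using at most $3\lceil \log_2\alpha\rceil$ colours such that all edges of $G$ are satisfied, except possibly for the edges of a set $M$ of uncoloured edges forming a matching.
   Context: All graphs are simple and finite. A partial edge colouring assigns colours to some (not necessarily all) edges. For an edge $e=uv$, $E[e]$ is the set of all edges incident with $u$ or $v$ and $E(e)=E[e]\setminus\{e\}$. A colour $\beta$ is unique for $e$ if some $e'\in E(e)$ is coloured $\beta$ and no other edge of $E[e]\setminus\{e'\}$ is coloured $\beta$; $e$ is satisfied if such a colour exists. -}

module Defs where

open import Data.Nat using (ℕ; _*_; _≥_)
open import Data.Nat.Logarithm using (⌈log₂_⌉)
open import Data.Fin using (Fin)
open import Data.Bool using (Bool; true; false)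
open import Data.Maybe using (Maybe; just; nothing)
open import Data.Product using (Σ; _×_; ∃; _,_)
open import Data.Sum using (_⊎_)
open import Relation.Nullary using (¬_)
open import Relation.Binary.PropositionalEquality using (_≡_; _≢_)

record SimpleGraph (n : ℕ) : Set where
  field
    adj     : Fin n → Fin n → Bool
    adj-sym : ∀ u v → adj u v ≡ adj v u
    irrefl  : ∀ u → adj u u ≡ false
open SimpleGraph public

module _ {n : ℕ} (G : SimpleGraph n) where

  IsEdge : Fin n → Fin n → Set
  IsEdge u v = adj G u v ≡ true

  ProperColouring : (α : ℕ) → (Fin n → Fin α) → Set
  ProperColouring α c = ∀ u v → IsEdge u v → c u ≢ c v

  ChromaticAtMost : ℕ → Set
  ChromaticAtMost α = Σ (Fin n → Fin α) (ProperColouring α)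

  record PartialEdgeColouring (k : ℕ) : Set where
    field
      col      : Fin n → Fin n → Maybe (Fin k)
      col-sym  : ∀ u v → col u v ≡ col v u
      col-edge : ∀ u v β → col u v ≡ just β → IsEdge u v
  open PartialEdgeColouring public

  SameEdge : Fin n → Fin n → Fin n → Fin n → Set
  SameEdge x y u v = (x ≡ u × y ≡ v) ⊎ (x ≡ v × y ≡ u)

  InClosedNbhd : Fin n → Fin n → Fin n → Fin n → Set
  InClosedNbhd u v x y =
    IsEdge x y × (x ≡ u ⊎ x ≡ v ⊎ y ≡ u ⊎ y ≡ v)

  UniqueFor : {k : ℕ} → PartialEdgeColouring k → Fin n → Fin n → Fin k → Set
  UniqueFor φ u v β =
    Σ (Fin n) λ x' → Σ (Fin n) λ y' →
      InClosedNbhd u v x' y' × ¬ SameEdge x' y' u v × col φ x' y' ≡ just β ×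
      (∀ x y → InClosedNbhd u v x y → ¬ SameEdge x y x' y' → col φ x y ≢ just β)

  Satisfied : {k : ℕ} → PartialEdgeColouring k → Fin n → Fin n → Set
  Satisfied φ u v = ∃ λ β → UniqueFor φ u v β

  IsUncolouredMatching : {k : ℕ} → PartialEdgeColouring k → (Fin n → Fin n → Bool) → Set
  IsUncolouredMatching φ M =
    (∀ u v → M u v ≡ M v u) ×
    (∀ u v → M u v ≡ true → IsEdge u v × col φ u v ≡ nothing) ×
    (∀ u v x y → M u v ≡ true → M x y ≡ true →
       (x ≡ u ⊎ x ≡ v ⊎ y ≡ u ⊎ y ≡ v) → SameEdge x y u v)

{-# OPTIONS --safe #-}
module Submission where

-- Split G by the first binary digit of the vertex colours. By induction the edges inside the two
-- halves are coloured up to an uncoloured matching M. The bipartite graph of cross edges is enlarged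
-- to a bipartite graph H by edges of M, each joining a component of H that is a single edge to the
-- rest, until no vertex of such a component is on an edge of M outside H. Three new colours satisfy
-- all edges of H except its isolated edges, which together with M ∖ H still form a matching.
--
-- To colour a connected bipartite H with at least two edges, root it at a vertex r without pendant
-- neighbours and let L₁, L₂, … be the levels by distance from r. Colouring the edges of a breadth-first
-- tree by level mod 3 satisfies every edge not at r: the end nearer to r has a tree edge to its parent
-- whose colour is not seen at the other end. To satisfy the edges at r as well, take a maximal matching
-- between L₁ and L₂ ("hubs" are the matched vertices of L₁). A hub has colour 0 on its edge to r, colour 1
-- on its matching edge and colour 2 on its other tree edges, so colour 1 is unique at the hub.
-- An unmatched vertex of L₁ has only matched neighbours in L₂ and hangs from one of them.

open import Defs
open import Data.Nat using (ℕ; zero; suc; _+_; _*_; _∸_; _^_; _≤_; _≥_; z≤n; s≤s; ⌊_/2⌋; ⌈_/2⌉)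
open import Data.Nat.Logarithm using (⌈log₂_⌉; ⌈log₂⌉-mono-≤; ⌈log₂⌈n/2⌉⌉≡⌈log₂n⌉∸1)
open import Data.Nat.Properties using (≤-trans; ≤-antisym; suc-injective; ≤∧≢⇒<; ≤-pred; m≤n⇒m<n∨m≡n)
import Data.Nat.Properties as ℕ
open import Data.Fin using (Fin; zero; suc; _↑ˡ_; _↑ʳ_; splitAt; remQuot; combine; inject≤)
open import Data.Fin.Properties using (_≟_; any?; all?; ↑ˡ-injective; ↑ʳ-injective; splitAt-↑ˡ; splitAt-↑ʳ;
  combine-remQuot; inject≤-injective)
open import Data.Bool using (Bool; true; false; not)
open import Data.Bool.Properties using (not-¬; ¬-not)
import Data.Bool.Properties as Bool
open import Data.Maybe using (Maybe; just; nothing)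
open import Data.Maybe.Properties using (just-injective)
import Data.Maybe.Properties as Maybe
open import Data.List using (List; []; _∷_; allFin; cartesianProduct)
open import Data.List.Membership.Propositional.Properties using (∈-allFin; ∈-cartesianProduct⁺)
open import Data.List.Relation.Unary.All using (All; []; _∷_)
import Data.List.Relation.Unary.All as All
open import Data.Product using (Σ; ∃; ∃-syntax; _×_; _,_; proj₁; proj₂; map₂; uncurry)
open import Data.Sum using (_⊎_; inj₁; inj₂)
import Data.Sum as Sum
open import Function using (_∘_; id; case_of_; mk⇔)
open import Relation.Nullary using (¬_; Dec; yes; no; does; contradiction)
open import Relation.Nullary.Decidable using (_×-dec_; _→-dec_; _⊎-dec_; ¬?; dec-true; dec-false; does-⇔)
open import Relation.Binary.Construct.Closure.ReflexiveTransitive using (Star; ε; _◅_; _◅◅_; reverse)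
open import Relation.Binary.PropositionalEquality

-- Saturation over pairs of vertices, and least witnesses

-- One sweep over all pairs suffices, because a step never undoes a pair already `Done`. This is the
-- common engine behind components, a maximal matching and a maximal bipartite extension, so each of
-- these has its `Done` phrased to persist as the state grows.
saturate : {n : ℕ} {S : Set} (Done : Fin n → Fin n → S → Set) →
  (∀ a b s → ∃[ t ] (∀ c d → Done c d s → Done c d t) × Done a b t) →
  S → ∃[ t ] (∀ a b → Done a b t)
saturate {n} {S} Done step s₀ =
  let t , _ , all = sweep (cartesianProduct (allFin n) (allFin n)) s₀
  in t , λ a b → All.lookup all (∈-cartesianProduct⁺ (∈-allFin a) (∈-allFin b))
  where
  sweep : ∀ ps s → ∃[ t ] (∀ c d → Done c d s → Done c d t) × All (λ (a , b) → Done a b t) ps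
  sweep []             s = s , (λ _ _ → id) , []
  sweep ((a , b) ∷ ps) s =
    let s′ , keep , done = step a b s
        t , keep′ , all = sweep ps s′
    in t , (λ c d → keep′ c d ∘ keep c d) , keep′ a b done ∷ all

least : {P : ℕ → Set} → (∀ k → Dec (P k)) → ∀ k → P k → ∃[ m ] P m × (∀ j → P j → m ≤ j)
least P? zero    p = zero , p , λ _ _ → z≤n
least P? (suc k) p with P? zero
... | yes p₀ = zero , p₀ , λ _ _ → z≤n
... | no ¬p₀ =
  let m , q , min = least (P? ∘ suc) k p
  in suc m , q , λ { zero p₀ → contradiction p₀ ¬p₀ ; (suc j) r → s≤s (min j r) }

does⇒ : {A : Set} (a? : Dec A) → does a? ≡ true → A
does⇒ (yes a) _ = a

-- Colours modulo 3

next : Fin 3 → Fin 3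
next zero             = suc zero
next (suc zero)       = suc (suc zero)
next (suc (suc zero)) = zero

next≢ : ∀ c → next c ≢ c
next≢ zero             ()
next≢ (suc zero)       ()
next≢ (suc (suc zero)) ()

next²≢ : ∀ c → next (next c) ≢ c
next²≢ zero             ()
next²≢ (suc zero)       ()
next²≢ (suc (suc zero)) ()

-- Isolated edges, pendant neighbours and satisfied edges

module _ {n : ℕ} (G : SimpleGraph n) where

  edge? : ∀ u v → Dec (IsEdge G u v)
  edge? u v = adj G u v Bool.≟ true

  edge-sym : ∀ {u v} → IsEdge G u v → IsEdge G v u
  edge-sym {u} {v} = trans (adj-sym G v u)

  edge-irrefl : ∀ {u v} → IsEdge G u v → u ≢ v
  edge-irrefl {u} e refl = contradiction (trans (sym e) (irrefl G u)) λ ()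

  IsolatedEdge : Fin n → Fin n → Set
  IsolatedEdge u v = (∀ w → IsEdge G u w → w ≡ v) × (∀ w → IsEdge G v w → w ≡ u)

  isolatedEdge? : ∀ u v → Dec (IsolatedEdge u v)
  isolatedEdge? u v =
    all? (λ w → edge? u w →-dec (w ≟ v)) ×-dec all? (λ w → edge? v w →-dec (w ≟ u))

  -- The exception is unavoidable: in a component that is a single edge, either choice of root has a
  -- pendant neighbour.
  NoPendantNeighbour : Fin n → Set
  NoPendantNeighbour r = ∀ y → IsEdge G r y → (∀ z → IsEdge G y z → z ≡ r) → IsolatedEdge r y

module _ {n : ℕ} {G : SimpleGraph n} {k : ℕ} (φ : PartialEdgeColouring G k) where

  Satisfied-sym : ∀ {u v} → Satisfied G φ u v → Satisfied G φ v u
  Satisfied-sym {u} {v} (β , x , y , (e , at) , ≢uv , φxy , uniq) =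
    β , x , y , (e , swapEnds at) , ≢uv ∘ swapSame , φxy ,
    λ a b (f , at′) → uniq a b (f , swapEnds at′)
    where
    swapEnds : ∀ {a b u v : Fin n} →
      (a ≡ u ⊎ a ≡ v ⊎ b ≡ u ⊎ b ≡ v) → (a ≡ v ⊎ a ≡ u ⊎ b ≡ v ⊎ b ≡ u)
    swapEnds (inj₁ p)               = inj₂ (inj₁ p)
    swapEnds (inj₂ (inj₁ p))        = inj₁ p
    swapEnds (inj₂ (inj₂ (inj₁ p))) = inj₂ (inj₂ (inj₂ p))
    swapEnds (inj₂ (inj₂ (inj₂ p))) = inj₂ (inj₂ (inj₁ p))
    swapSame : ∀ {a b u v} → SameEdge G a b u v → SameEdge G a b v u
    swapSame (inj₁ p) = inj₂ p
    swapSame (inj₂ p) = inj₁ p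

  -- The witness is always the edge `uz`: it is the only edge of colour `β` at `u`, and `v` sees no
  -- `β`. Every use below has this one-sided form.
  satisfied-at : ∀ {u v z β} → IsEdge G u v → col φ u z ≡ just β → z ≢ v →
    (∀ w → col φ u w ≡ just β → w ≡ z) → (∀ w → col φ v w ≢ just β) →
    Satisfied G φ u v
  satisfied-at {u} {v} {z} {β} uv φuz z≢v uniq free =
    β , u , z , (col-edge φ u z β φuz , inj₁ refl) ,
    (λ { (inj₁ (_ , z≡v)) → z≢v z≡v ; (inj₂ (u≡v , _)) → edge-irrefl G uv u≡v }) ,
    φuz , other
    where
    flip : ∀ {a b} → col φ a b ≡ just β → col φ b a ≡ just β
    flip {a} {b} = trans (col-sym φ b a)
    other : ∀ x y → InClosedNbhd G u v x y → ¬ SameEdge G x y u z → col φ x y ≢ just β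
    other x y (_ , inj₁ refl)               ≢uz φxy = ≢uz (inj₁ (refl , uniq y φxy))
    other x y (_ , inj₂ (inj₁ refl))        ≢uz φxy = free y φxy
    other x y (_ , inj₂ (inj₂ (inj₁ refl))) ≢uz φxy = ≢uz (inj₂ (uniq x (flip φxy) , refl))
    other x y (_ , inj₂ (inj₂ (inj₂ refl))) ≢uz φxy = free x (flip φxy)

-- Distance levels in a bipartite graph

record Levelling {n : ℕ} (H : SimpleGraph n) : Set where
  field
    root           : Fin n → Fin n
    level          : Fin n → ℕ
    root-edge      : ∀ {x y} → IsEdge H x y → root x ≡ root y
    root-noPendant : ∀ x → NoPendantNeighbour H (root x)
    level-root     : ∀ x → level (root x) ≡ 0
    level-zero     : ∀ {x} → level x ≡ 0 → x ≡ root x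
    level-suc      : ∀ {x k} → level x ≡ suc k → ∃[ y ] IsEdge H x y × level y ≡ k
    -- This is the form in which bipartiteness reaches the colouring: an edge within one level never
    -- has to be treated.
    level-adjacent : ∀ {x y} → IsEdge H x y → level y ≡ suc (level x) ⊎ level x ≡ suc (level y)

-- An isolated edge has no other edge at its ends, so no colouring of `H` satisfies it. It is left
-- uncoloured so that it can go into the final matching.
SatisfiedOrIsolated : ∀ {n} (H : SimpleGraph n) → PartialEdgeColouring H 3 → Set
SatisfiedOrIsolated H φ = ∀ u v → IsEdge H u v →
  Satisfied H φ u v ⊎ (IsolatedEdge H u v × col φ u v ≡ nothing)

module Distances {n : ℕ} (H : SimpleGraph n) (side : Fin n → Bool)
  (proper : ∀ u v → IsEdge H u v → side u ≢ side v) where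

  infix 4 _~_
  _~_ : Fin n → Fin n → Set
  _~_ = IsEdge H

  -- Union–find: merging the classes of a and b for every edge ab leaves exactly the components.
  components : Σ (Fin n → Fin n) λ rep →
    (∀ x → Star _~_ x (rep x)) × (∀ a b → a ~ b → rep a ≡ rep b)
  components =
    let (rep , conn) , done = saturate Done step ((λ x → x) , λ _ → ε) in rep , conn , done
    where
    State = Σ (Fin n → Fin n) λ rep → ∀ x → Star _~_ x (rep x)
    Done : Fin n → Fin n → State → Set
    Done a b (rep , _) = a ~ b → rep a ≡ rep b
    step : ∀ a b s → ∃[ t ] (∀ c d → Done c d s → Done c d t) × Done a b t
    step a b s@(rep , conn) with edge? H a b
    ... | no ¬ab = s , (λ _ _ → id) , λ ab → contradiction ab ¬ab
    ... | yes ab =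
      ((merge ∘ rep) , λ x → merge-conn x) , (λ c d done cd → cong merge (done cd)) ,
      λ _ → trans merge-a (sym merge-b)
      where
      merge : Fin n → Fin n
      merge r with r ≟ rep a
      ... | yes _ = rep b
      ... | no  _ = r
      merge-conn : ∀ x → Star _~_ x (merge (rep x))
      merge-conn x with rep x ≟ rep a
      ... | no  _ = conn x
      ... | yes p =
        conn x ◅◅ subst (λ r → Star _~_ r a) (sym p) (reverse (edge-sym H) (conn a)) ◅◅ ab ◅ conn b
      merge-a : merge (rep a) ≡ rep b
      merge-a with rep a ≟ rep a
      ... | yes _ = refl
      ... | no ¬p = contradiction refl ¬p
      merge-b : merge (rep b) ≡ rep b
      merge-b with rep b ≟ rep a
      ... | yes _ = refl
      ... | no  _ = refl

  -- A pendant neighbour ℓ of r is the better root: its only neighbour is r, pendant only if rℓ is isolated.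
  goodRoot : ∀ r → ∃[ h ] Star _~_ r h × NoPendantNeighbour H h
  goodRoot r with any? (λ ℓ → edge? H r ℓ ×-dec all? (λ z → edge? H ℓ z →-dec (z ≟ r)))
  ... | yes (ℓ , rℓ , only-r) = ℓ , rℓ ◅ ε , λ y ℓy only-ℓ →
        (λ w ℓw → trans (only-r w ℓw) (sym (only-r y ℓy))) , only-ℓ
  ... | no none = r , ε , λ y ry only-r → contradiction (y , ry , only-r) none

  root : Fin n → Fin n
  root x = proj₁ (goodRoot (proj₁ components x))

  root-edge : ∀ {x y} → x ~ y → root x ≡ root y
  root-edge {x} {y} xy = cong (λ r → proj₁ (goodRoot r)) (proj₂ (proj₂ components) x y xy)

  root-conn : ∀ x → Star _~_ x (root x)
  root-conn x = proj₁ (proj₂ components) x ◅◅ proj₁ (proj₂ (goodRoot (proj₁ components x)))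

  root-noPendant : ∀ x → NoPendantNeighbour H (root x)
  root-noPendant x = proj₂ (proj₂ (goodRoot (proj₁ components x)))

  root-star : ∀ {x y} → Star _~_ x y → root x ≡ root y
  root-star ε        = refl
  root-star (e ◅ es) = trans (root-edge e) (root-star es)

  -- The far end needs no parameter: `root` is constant along edges, so a walk that stops at its own
  -- root stops at `root x`.
  Walk : ℕ → Fin n → Set
  Walk zero    x = x ≡ root x
  Walk (suc k) x = ∃[ y ] x ~ y × Walk k y

  walk? : ∀ k x → Dec (Walk k x)
  walk? zero    x = x ≟ root x
  walk? (suc k) x = any? (λ y → edge? H x y ×-dec walk? k y)

  walk : ∀ x → ∃[ k ] Walk k x
  walk x = along (root-conn x) (sym (root-star (root-conn x)))
    where
    along : ∀ {x y} → Star _~_ x y → root y ≡ y → ∃[ k ] Walk k x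
    along ε        y-root = 0 , sym y-root
    along (e ◅ es) y-root = let k , w = along es y-root in suc k , _ , e , w

  shortest : ∀ x → ∃[ k ] Walk k x × (∀ j → Walk j x → k ≤ j)
  shortest x = least (λ k → walk? k x) (proj₁ (walk x)) (proj₂ (walk x))

  level : Fin n → ℕ
  level x = proj₁ (shortest x)

  level-walk : ∀ x → Walk (level x) x
  level-walk x = proj₁ (proj₂ (shortest x))

  level-min : ∀ x j → Walk j x → level x ≤ j
  level-min x = proj₂ (proj₂ (shortest x))

  level-edge : ∀ {x y} → x ~ y → level x ≤ suc (level y)
  level-edge {x} {y} xy = level-min x _ (y , xy , level-walk y)

  level-zero : ∀ {x} → level x ≡ 0 → x ≡ root x
  level-zero {x} l≡0 = subst (λ k → Walk k x) l≡0 (level-walk x)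

  level-root : ∀ x → level (root x) ≡ 0
  level-root x = ℕ.n≤0⇒n≡0 (level-min (root x) 0 (root-star (root-conn x)))

  -- Take the second vertex of a shortest walk. The rest of that walk bounds its level above by `k`,
  -- and `level-edge` bounds it below.
  level-suc : ∀ {x k} → level x ≡ suc k → ∃[ y ] x ~ y × level y ≡ k
  level-suc {x} {k} l≡ with y , xy , w ← subst (λ k → Walk k x) l≡ (level-walk x) =
    y , xy , ≤-antisym (level-min y k w) (≤-pred (subst (_≤ suc (level y)) l≡ (level-edge xy)))

  parity : ℕ → Bool → Bool
  parity zero    b = b
  parity (suc k) b = not (parity k b)

  -- The side changes at every step of the walk, so it is determined by the root and the parity of
  -- the length. Hence adjacent vertices, which share a root, cannot share a level.
  walk-side : ∀ k {x} → Walk k x → side x ≡ parity k (side (root x))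
  walk-side zero    x≡r          = cong side x≡r
  walk-side (suc k) {x} (y , xy , w) =
    trans (¬-not (proper x y xy))
      (cong not (trans (walk-side k w) (cong (parity k ∘ side) (sym (root-edge xy)))))

  level≢ : ∀ {x y} → x ~ y → level x ≢ level y
  level≢ {x} {y} xy l≡ = proper x y xy (begin
    side x                             ≡⟨ walk-side (level x) (level-walk x) ⟩
    parity (level x) (side (root x))   ≡⟨ cong₂ (λ k r → parity k (side r)) l≡ (root-edge xy) ⟩
    parity (level y) (side (root y))   ≡⟨ walk-side (level y) (level-walk y) ⟨
    side y                             ∎)
    where open ≡-Reasoning

  level-adjacent : ∀ {x y} → x ~ y → level y ≡ suc (level x) ⊎ level x ≡ suc (level y)
  level-adjacent {x} {y} xy with m≤n⇒m<n∨m≡n (level-edge xy)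
  ... | inj₂ eq = inj₂ eq
  ... | inj₁ lx<1+ly = inj₁ (≤-antisym (level-edge (edge-sym H xy))
          (≤∧≢⇒< (≤-pred lx<1+ly) (level≢ xy)))

  levelling : Levelling H
  levelling = record
    { root = root ; level = level ; root-edge = root-edge ; root-noPendant = root-noPendant
    ; level-root = level-root ; level-zero = level-zero ; level-suc = level-suc
    ; level-adjacent = level-adjacent }

-- A maximal matching between levels 1 and 2

module Matchings {n : ℕ} {H : SimpleGraph n} (L : Levelling H) where
  open Levelling L

  infix 4 _~_
  _~_ : Fin n → Fin n → Set
  _~_ = IsEdge H

  record PartialMatching : Set where
    field
      mate       : Fin n → Maybe (Fin n)
      mate-sym   : ∀ {x y} → mate x ≡ just y → mate y ≡ just x
      mate-edge  : ∀ {x y} → mate x ≡ just y → x ~ y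
      mate-level : ∀ {x y} → mate x ≡ just y → level x ≡ 1 × level y ≡ 2 ⊎ level x ≡ 2 × level y ≡ 1

  Matched : (Fin n → Maybe (Fin n)) → Fin n → Set
  Matched mate x = ∃[ y ] mate x ≡ just y

  -- Maximality, one pair at a time. Matched vertices stay matched when the matching is extended, so
  -- the property survives the sweep.
  Blocked : Fin n → Fin n → PartialMatching → Set
  Blocked a b m = a ~ b → level a ≡ 1 → level b ≡ 2 → Matched mate a ⊎ Matched mate b
    where open PartialMatching m

  module Extend (m : PartialMatching) {a b : Fin n} (ab : a ~ b)
    (level-a : level a ≡ 1) (level-b : level b ≡ 2)
    (a-free : PartialMatching.mate m a ≡ nothing) (b-free : PartialMatching.mate m b ≡ nothing) where
    open PartialMatching m

    a≢b : a ≢ b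
    a≢b = edge-irrefl H ab

    mate⁺ : Fin n → Maybe (Fin n)
    mate⁺ x with x ≟ a | x ≟ b
    ... | yes _ | _     = just b
    ... | no _  | yes _ = just a
    ... | no _  | no _  = mate x

    mate⁺-a : mate⁺ a ≡ just b
    mate⁺-a with a ≟ a | a ≟ b
    ... | yes _ | _ = refl
    ... | no ¬p | _ = contradiction refl ¬p

    mate⁺-b : mate⁺ b ≡ just a
    mate⁺-b with b ≟ a | b ≟ b
    ... | yes p | _     = contradiction (sym p) a≢b
    ... | no _  | yes _ = refl
    ... | no _  | no ¬p = contradiction refl ¬p

    mate⁺-old : ∀ {x y} → mate x ≡ just y → mate⁺ x ≡ just y
    mate⁺-old {x} mx with x ≟ a | x ≟ b
    ... | yes refl | _        = case trans (sym a-free) mx of λ ()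
    ... | no _     | yes refl = case trans (sym b-free) mx of λ ()
    ... | no _     | no _     = mx

    mate⁺-cases : ∀ {x y} → mate⁺ x ≡ just y → (x ≡ a × y ≡ b) ⊎ (x ≡ b × y ≡ a) ⊎ mate x ≡ just y
    mate⁺-cases {x} eq with x ≟ a | x ≟ b
    mate⁺-cases refl | yes p | _     = inj₁ (p , refl)
    mate⁺-cases refl | no _  | yes p = inj₂ (inj₁ (p , refl))
    mate⁺-cases eq   | no _  | no _  = inj₂ (inj₂ eq)

    extended : PartialMatching
    extended = record
      { mate       = mate⁺
      ; mate-sym   = λ {x} eq → case mate⁺-cases {x} eq of λ
          { (inj₁ (refl , refl))        → mate⁺-b
          ; (inj₂ (inj₁ (refl , refl))) → mate⁺-a
          ; (inj₂ (inj₂ old))           → mate⁺-old (mate-sym old) }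
      ; mate-edge  = λ {x} eq → case mate⁺-cases {x} eq of λ
          { (inj₁ (refl , refl))        → ab
          ; (inj₂ (inj₁ (refl , refl))) → edge-sym H ab
          ; (inj₂ (inj₂ old))           → mate-edge old }
      ; mate-level = λ {x} eq → case mate⁺-cases {x} eq of λ
          { (inj₁ (refl , refl))        → inj₁ (level-a , level-b)
          ; (inj₂ (inj₁ (refl , refl))) → inj₂ (level-b , level-a)
          ; (inj₂ (inj₂ old))           → mate-level old } }

  maximalMatching : ∃[ m ] (∀ a b → Blocked a b m)
  maximalMatching = saturate Blocked step empty
    where
    empty : PartialMatching
    empty = record
      { mate = λ _ → nothing ; mate-sym = λ () ; mate-edge = λ () ; mate-level = λ () }
    step : ∀ a b m → ∃[ t ] (∀ c d → Blocked c d m → Blocked c d t) × Blocked a b t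
    step a b m with edge? H a b | level a ℕ.≟ 1 | level b ℕ.≟ 2
                  | PartialMatching.mate m a in ma | PartialMatching.mate m b in mb
    ... | no ¬ab | _ | _ | _ | _ = m , (λ _ _ → id) , λ ab → contradiction ab ¬ab
    ... | yes _ | no ¬la | _ | _ | _ = m , (λ _ _ → id) , λ _ la → contradiction la ¬la
    ... | yes _ | yes _ | no ¬lb | _ | _ = m , (λ _ _ → id) , λ _ _ lb → contradiction lb ¬lb
    ... | yes _ | yes _ | yes _ | just y | _ = m , (λ _ _ → id) , λ _ _ _ → inj₁ (y , ma)
    ... | yes _ | yes _ | yes _ | nothing | just y = m , (λ _ _ → id) , λ _ _ _ → inj₂ (y , mb)
    ... | yes ab | yes la | yes lb | nothing | nothing =
      extended , (λ c d blocked cd lc ld → Sum.map (map₂ mate⁺-old) (map₂ mate⁺-old) (blocked cd lc ld)) ,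
      λ _ _ _ → inj₁ (b , mate⁺-a)
      where open Extend m ab la lb ma mb

-- Ownership of edges and the colours that it prescribes

module Owners {n : ℕ} {H : SimpleGraph n} (L : Levelling H) (m : Matchings.PartialMatching L)
  (maximal : ∀ a b → Matchings.Blocked L a b m) where
  open Levelling L
  open Matchings L using (_~_; Matched)
  open Matchings.PartialMatching m

  mate-just : ∀ {x y} → mate x ≡ just y → mate x ≢ nothing
  mate-just p q = case trans (sym p) q of λ ()

  matched-neighbour : ∀ {x y} → x ~ y → level x ≡ 1 → level y ≡ 2 → mate x ≡ nothing → Matched mate y
  matched-neighbour xy lx ly free with maximal _ _ xy lx ly
  ... | inj₁ (_ , mx) = contradiction free (mate-just mx)
  ... | inj₂ my       = my

  -- On level 2 + k the colours base k and base (k + 1) are used; the second one is reserved for the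
  -- vertices that a shortest path joins to an unmatched vertex of level 2.
  Primed : ℕ → Fin n → Set
  Primed zero    x = mate x ≡ nothing
  Primed (suc k) x = ∃[ y ] x ~ y × level y ≡ 2 + k × Primed k y

  primed? : ∀ k x → Dec (Primed k x)
  primed? zero    x = Maybe.≡-dec _≟_ (mate x) nothing
  primed? (suc k) x = any? (λ y → edge? H x y ×-dec (level y ℕ.≟ 2 + k) ×-dec primed? k y)

  base : ℕ → Fin 3
  base zero    = suc zero
  base (suc k) = next (base k)

  data Tone (k : ℕ) (x : Fin n) : Fin 3 → Set where
    plain  : ¬ Primed k x → Tone k x (base k)
    primed : Primed k x → Tone k x (base (suc k))

  tone-unique : ∀ {k x c d} → Tone k x c → Tone k x d → c ≡ d
  tone-unique (plain _)  (plain _)  = refl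
  tone-unique (plain ¬p) (primed p) = contradiction p ¬p
  tone-unique (primed p) (plain ¬p) = contradiction p ¬p
  tone-unique (primed _) (primed _) = refl

  -- The bad combination would be a primed `x` below a plain `y`, both then having the colour
  -- `base (suc k)`. It cannot occur, since a primed neighbour one level nearer to the root makes
  -- `y` primed. In the other cases the colours are consecutive modulo 3, in one order or the other.
  tone-step : ∀ {k x y c d} → x ~ y → level x ≡ 2 + k → Tone k x c → Tone (suc k) y d →
    d ≡ next c ⊎ c ≡ next d
  tone-step xy lx (plain _)  (plain _)  = inj₁ refl
  tone-step {k} xy lx (plain _) (primed _) = inj₂ (next³ (base k))
    where
    next³ : ∀ c → c ≡ next (next (next c))
    next³ zero             = refl
    next³ (suc zero)       = refl
    next³ (suc (suc zero)) = refl
  tone-step xy lx (primed p) (plain ¬p) = contradiction (_ , edge-sym H xy , lx , p) ¬p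
  tone-step xy lx (primed _) (primed _) = inj₁ refl

  -- Role x o c: the vertex x owns the edge to o (if any), which gets the colour c.
  data Role (x : Fin n) : Maybe (Fin n) → Fin 3 → Set where
    top       : level x ≡ 0 → Role x nothing zero
    hub       : ∀ {w} → level x ≡ 1 → mate x ≡ just w → Role x (just (root x)) zero
    spare     : ∀ {w v} → level x ≡ 1 → mate x ≡ nothing → x ~ w → level w ≡ 2 → mate w ≡ just v →
                Role x (just w) (suc (suc zero))
    stray     : level x ≡ 1 → (∀ w → x ~ w → level w ≢ 2) → Role x nothing (suc (suc zero))
    matched   : ∀ {v} → level x ≡ 2 → mate x ≡ just v → Role x (just v) (suc zero)
    unmatched : ∀ {v} → level x ≡ 2 → mate x ≡ nothing → x ~ v → level v ≡ 1 →
                Role x (just v) (suc (suc zero))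
    deep      : ∀ {k y c} → level x ≡ 3 + k → x ~ y → level y ≡ 2 + k → Tone k y c →
                Tone (suc k) x (next c) → Role x (just y) (next c)

  role : ∀ x → ∃[ o ] ∃[ c ] Role x o c
  role x with level x in lx
  ... | 0 = _ , _ , top lx
  ... | 1 with mate x in mx
  ...   | just w = _ , _ , hub lx mx
  ...   | nothing with any? (λ w → edge? H x w ×-dec (level w ℕ.≟ 2))
  ...     | yes (w , xw , lw) = _ , _ , spare lx mx xw lw (proj₂ (matched-neighbour xw lx lw mx))
  ...     | no none = _ , _ , stray lx λ w xw lw → none (w , xw , lw)
  role x | 2 with mate x in mx
  ... | just v = _ , _ , matched lx mx
  ... | nothing = let v , xv , lv = level-suc lx in _ , _ , unmatched lx mx xv lv
  role x | suc (suc (suc k)) with primed? (suc k) x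
  -- A primed vertex hangs from a primed neighbour. A plain vertex may hang from any neighbour on
  -- the previous level, as all of these are plain. Either way its tone is `next` of its parent's
  -- tone.
  ... | yes p@(y , xy , ly , q) = _ , _ , deep lx xy ly (primed q) (primed p)
  ... | no ¬p = let y , xy , ly = level-suc lx in
                _ , _ , deep lx xy ly (plain λ q → ¬p (y , xy , ly , q)) (plain ¬p)

  own : Fin n → Maybe (Fin n)
  own x = proj₁ (role x)

  hue : Fin n → Fin 3
  hue x = proj₁ (proj₂ (role x))

  hasRole : ∀ x → Role x (own x) (hue x)
  hasRole x = proj₂ (proj₂ (role x))

  -- Neither roots nor hubs: the vertices at which the colouring follows the uniform rule of
  -- `owned-by-ordinary`.
  Ordinary : Fin n → Set
  Ordinary x = (level x ≡ 1 × mate x ≡ nothing) ⊎ (∃[ k ] level x ≡ 2 + k)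

  data Kind (x : Fin n) : Set where
    isRoot     : level x ≡ 0 → Kind x
    isHub      : ∀ {w} → level x ≡ 1 → mate x ≡ just w → Kind x
    isOrdinary : Ordinary x → Kind x

  kind : ∀ x → Kind x
  kind x with level x in lx | mate x in mx
  ... | 0           | _       = isRoot lx
  ... | 1           | just _  = isHub lx mx
  ... | 1           | nothing = isOrdinary (inj₁ (lx , mx))
  ... | suc (suc k) | _       = isOrdinary (inj₂ (k , lx))

  clash : ∀ {A : Set} {x i j : ℕ} → x ≡ i → x ≡ j → i ≢ j → A
  clash p q i≢j = contradiction (trans (sym p) q) i≢j

  level-2+ : ∀ {x j k} → level x ≡ 2 + j → level x ≡ 2 + k → j ≡ k
  level-2+ p q = suc-injective (suc-injective (trans (sym p) q))

  tone : ∀ {x o c k} → Role x o c → level x ≡ 2 + k → Tone k x c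
  tone (top lx)           l = clash lx l λ ()
  tone (hub lx _)         l = clash lx l λ ()
  tone (spare lx _ _ _ _) l = clash lx l λ ()
  tone (stray lx _)       l = clash lx l λ ()
  tone (matched lx mx)    l with refl ← level-2+ lx l = plain (mate-just mx)
  tone (unmatched lx mx _ _) l with refl ← level-2+ lx l = primed mx
  tone (deep lx _ _ _ t)  l with refl ← level-2+ lx l = t

  -- A `stray` vertex owns no edge; its hue is a placeholder that makes this hold for every
  -- unmatched vertex of level 1.
  free-hue : ∀ {x o c} → Role x o c → level x ≡ 1 → mate x ≡ nothing → c ≡ suc (suc zero)
  free-hue (top lx)             l _  = clash lx l λ ()
  free-hue (hub _ mx)           _ mx′ = contradiction mx′ (mate-just mx)
  free-hue (spare _ _ _ _ _)    _ _  = refl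
  free-hue (stray _ _)          _ _  = refl
  free-hue (matched lx _)       l _  = clash lx l λ ()
  free-hue (unmatched lx _ _ _) l _  = clash lx l λ ()
  free-hue (deep lx _ _ _ _)    l _  = clash lx l λ ()

  owner-level : ∀ {x y c} → Role x (just y) c → level x ≢ 0
  owner-level (hub lx _)           l = clash lx l λ ()
  owner-level (spare lx _ _ _ _)   l = clash lx l λ ()
  owner-level (matched lx _)       l = clash lx l λ ()
  owner-level (unmatched lx _ _ _) l = clash lx l λ ()
  owner-level (deep lx _ _ _ _)    l = clash lx l λ ()

  hub-owns : ∀ {x o c w} → Role x o c → level x ≡ 1 → mate x ≡ just w → o ≡ just (root x) × c ≡ zero
  hub-owns (top lx)             l _  = clash lx l λ ()
  hub-owns (hub _ _)            _ _  = refl , refl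
  hub-owns (spare _ mx′ _ _ _)  _ mx = contradiction mx′ (mate-just mx)
  hub-owns (stray lx none)      l mx = case mate-level mx of λ
    { (inj₁ (_ , lw)) → contradiction lw (none _ (mate-edge mx)) ; (inj₂ (l₂ , _)) → clash l l₂ λ () }
  hub-owns (matched lx _)       l _  = clash lx l λ ()
  hub-owns (unmatched lx _ _ _) l _  = clash lx l λ ()
  hub-owns (deep lx _ _ _ _)    l _  = clash lx l λ ()

  mate-owns : ∀ {x o c v} → Role x o c → level x ≡ 2 → mate x ≡ just v → o ≡ just v × c ≡ suc zero
  mate-owns (top lx)              l _  = clash lx l λ ()
  mate-owns (hub lx _)            l _  = clash lx l λ ()
  mate-owns (spare lx _ _ _ _)    l _  = clash lx l λ ()
  mate-owns (stray lx _)          l _  = clash lx l λ ()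
  mate-owns (matched _ mx′)       _ mx = trans (sym mx′) mx , refl
  mate-owns (unmatched _ mx′ _ _) _ mx = contradiction mx′ (mate-just mx)
  mate-owns (deep lx _ _ _ _)     l _  = clash lx l λ ()

  -- Only hubs own an edge to the root: unmatched vertices of level 1 hang from level 2 or own
  -- nothing. So the root sees at most colour 0.
  owned-by-root : ∀ {x y c} → Role x (just y) c → level y ≡ 0 → c ≡ zero
  owned-by-root (hub _ _)             _ = refl
  owned-by-root (spare _ _ _ ly _)    l = clash ly l λ ()
  owned-by-root (matched lx mx)       l = case mate-level mx of λ
    { (inj₁ (lx′ , _)) → clash lx lx′ λ () ; (inj₂ (_ , ly)) → clash ly l λ () }
  owned-by-root (unmatched _ _ _ ly)  l = clash ly l λ ()
  owned-by-root (deep _ _ ly _ _)     l = clash ly l λ ()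

  -- A matched vertex of level 2 owns the edge to its own mate, so among the edges owned from level
  -- 2 colour 1 reaches a hub just once; unmatched vertices bring colour 2.
  owned-by-hub : ∀ {x y c w} → Role x (just y) c → level y ≡ 1 → mate y ≡ just w →
    (c ≡ suc zero × x ≡ w) ⊎ c ≡ suc (suc zero)
  owned-by-hub {x} (hub _ _)         l _  = clash (level-root x) l λ ()
  owned-by-hub (spare _ _ _ ly _)    l _  = clash ly l λ ()
  owned-by-hub (matched _ mx)        _ my = inj₁ (refl , just-injective (trans (sym (mate-sym mx)) my))
  owned-by-hub (unmatched _ _ _ _)   _ _  = inj₂ refl
  owned-by-hub (deep _ _ ly _ _)     l _  = clash ly l λ ()

  -- The main invariant: an ordinary vertex sees at most two colours, its hue on the edge that it
  -- owns and `next` of its hue on edges owned by others.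
  owned-by-ordinary : ∀ {x y o c d} → Role x (just y) c → Role y o d → Ordinary y → c ≡ next d
  owned-by-ordinary {x} (hub _ _) _ (inj₁ (ly , _)) = clash (level-root x) ly λ ()
  owned-by-ordinary {x} (hub _ _) _ (inj₂ (_ , ly)) = clash (level-root x) ly λ ()
  owned-by-ordinary (spare _ _ _ ly my) r _ with refl ← proj₂ (mate-owns r ly my) = refl
  owned-by-ordinary (matched lx mx) _ (inj₁ (_ , my)) = contradiction my (mate-just (mate-sym mx))
  owned-by-ordinary (matched lx mx) _ (inj₂ (_ , ly)) = case mate-level mx of λ
    { (inj₁ (lx′ , _)) → clash lx lx′ λ () ; (inj₂ (_ , ly′)) → clash ly ly′ λ () }
  -- By maximality an unmatched vertex of level 2 hangs from a hub, not from an unmatched vertex of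
  -- level 1.
  owned-by-ordinary (unmatched lx mx xy ly) _ (inj₁ (_ , my)) =
    contradiction mx (mate-just (proj₂ (matched-neighbour (edge-sym H xy) ly lx my)))
  owned-by-ordinary (unmatched _ _ _ ly) _ (inj₂ (_ , ly′)) = clash ly ly′ λ ()
  owned-by-ordinary (deep _ _ ly t _) r _ = cong next (tone-unique t (tone r ly))

  owner-edge : ∀ {x y c} → Role x (just y) c → x ~ y
  owner-edge {x} (hub lx _) with y , xy , ly ← level-suc lx =
    subst (x ~_) (trans (level-zero ly) (sym (root-edge xy))) xy
  owner-edge (spare _ _ xy _ _)   = xy
  owner-edge (matched _ mx)       = mate-edge mx
  owner-edge (unmatched _ _ xy _) = xy
  owner-edge (deep _ xy _ _ _)    = xy

  -- Makes the colour of an edge well defined. A root owns nothing and a hub owns only the edge to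
  -- its root; for two ordinary ends the invariant would give a hue equal to its second successor
  -- modulo 3.
  owner-asym : ∀ {x y c d} → Role x (just y) c → ¬ Role y (just x) d
  owner-asym {x} {y} rx ry with kind x | kind y
  ... | isRoot lx        | _                = owner-level rx lx
  ... | isHub lx mx      | _                =
    owner-level ry (trans (cong level (just-injective (proj₁ (hub-owns rx lx mx)))) (level-root x))
  ... | isOrdinary _     | isRoot ly        = owner-level ry ly
  ... | isOrdinary _     | isHub ly my      =
    owner-level rx (trans (cong level (just-injective (proj₁ (hub-owns ry ly my)))) (level-root y))
  ... | isOrdinary ord-x | isOrdinary ord-y =
    next²≢ _ (sym (trans (owned-by-ordinary rx ry ord-y) (cong next (owned-by-ordinary ry rx ord-x))))

  -- The edge colouring and the colours seen at each vertex

  Owns : Fin n → Fin n → Set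
  Owns x y = own x ≡ just y

  owns? : ∀ x y → Dec (Owns x y)
  owns? x y = Maybe.≡-dec _≟_ (own x) (just y)

  owns-role : ∀ {x y} → Owns x y → Role x (just y) (hue x)
  owns-role {x} eq = subst (λ o → Role x o (hue x)) eq (hasRole x)

  colour : Fin n → Fin n → Maybe (Fin 3)
  colour u v with owns? u v | owns? v u
  ... | yes _ | _     = just (hue u)
  ... | no _  | yes _ = just (hue v)
  ... | no _  | no _  = nothing

  colour-sym : ∀ u v → colour u v ≡ colour v u
  colour-sym u v with owns? u v | owns? v u
  ... | yes p | yes q = contradiction (owns-role q) (owner-asym (owns-role p))
  ... | yes _ | no _  = refl
  ... | no _  | yes _ = refl
  ... | no _  | no _  = refl

  colour-owned : ∀ {u v} → Owns u v → colour u v ≡ just (hue u)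
  colour-owned {u} {v} p with owns? u v
  ... | yes _ = refl
  ... | no ¬p = contradiction p ¬p

  colour-cases : ∀ {u v β} → colour u v ≡ just β → (Owns u v × β ≡ hue u) ⊎ (Owns v u × β ≡ hue v)
  colour-cases {u} {v} eq with owns? u v | owns? v u
  colour-cases refl | yes p | _     = inj₁ (p , refl)
  colour-cases refl | no _  | yes p = inj₂ (p , refl)

  φ : PartialEdgeColouring H 3
  φ = record
    { col      = colour
    ; col-sym  = colour-sym
    ; col-edge = λ u v β eq → case colour-cases {u} {v} eq of λ
        { (inj₁ (p , _)) → owner-edge (owns-role p)
        ; (inj₂ (p , _)) → edge-sym H (owner-edge (owns-role p)) } }

  ordinary-owns : ∀ {x o c} → Role x o c → Ordinary x →
    (∃[ z ] o ≡ just z) ⊎ (level x ≡ 1 × (∀ w → x ~ w → level w ≢ 2) × o ≡ nothing)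
  ordinary-owns (top lx) (inj₁ (l , _)) = clash lx l λ ()
  ordinary-owns (top lx) (inj₂ (_ , l)) = clash lx l λ ()
  ordinary-owns (hub _ _)             _ = inj₁ (_ , refl)
  ordinary-owns (spare _ _ _ _ _)     _ = inj₁ (_ , refl)
  ordinary-owns (stray lx none)       _ = inj₂ (lx , none , refl)
  ordinary-owns (matched _ _)         _ = inj₁ (_ , refl)
  ordinary-owns (unmatched _ _ _ _)   _ = inj₁ (_ , refl)
  ordinary-owns (deep _ _ _ _ _)      _ = inj₁ (_ , refl)

  above-owns : ∀ {x k} → level x ≡ 2 + k → ∃[ z ] Owns x z
  above-owns {x} {k} lx with ordinary-owns (hasRole x) (inj₂ (k , lx))
  ... | inj₁ z        = z
  ... | inj₂ (l , _) = clash lx l λ ()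

  colours-root : ∀ {r z β} → level r ≡ 0 → colour r z ≡ just β → β ≡ zero
  colours-root {r} {z} lr eq with colour-cases {r} {z} eq
  ... | inj₁ (p , _)    = contradiction lr (owner-level (owns-role p))
  ... | inj₂ (p , refl) = owned-by-root (owns-role p) lr

  colours-hub : ∀ {h w z β} → level h ≡ 1 → mate h ≡ just w → colour h z ≡ just β →
    (z ≡ root h × β ≡ zero) ⊎ (z ≡ w × β ≡ suc zero) ⊎ β ≡ suc (suc zero)
  colours-hub {h} {w} {z} lh mh eq with colour-cases {h} {z} eq
  ... | inj₁ (p , refl) =
    let o≡ , c≡ = hub-owns (hasRole h) lh mh in inj₁ (just-injective (trans (sym p) o≡) , c≡)
  ... | inj₂ (p , refl) with owned-by-hub (owns-role p) lh mh
  ...   | inj₁ (c≡ , z≡) = inj₂ (inj₁ (z≡ , c≡))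
  ...   | inj₂ c≡        = inj₂ (inj₂ c≡)

  colours-ordinary : ∀ {x z β} → Ordinary x → colour x z ≡ just β →
    (Owns x z × β ≡ hue x) ⊎ β ≡ next (hue x)
  colours-ordinary {x} {z} ord eq with colour-cases {x} {z} eq
  ... | inj₁ q          = inj₁ q
  ... | inj₂ (p , refl) = inj₂ (owned-by-ordinary (owns-role p) (hasRole x) ord)

  hub-root-colour : ∀ {h w} → level h ≡ 1 → mate h ≡ just w → colour h (root h) ≡ just zero
  hub-root-colour {h} lh mh =
    let o≡ , c≡ = hub-owns (hasRole h) lh mh in trans (colour-owned o≡) (cong just c≡)

  mate-above : ∀ {h w} → level h ≡ 1 → mate h ≡ just w → level w ≡ 2
  mate-above lh mh with mate-level mh
  ... | inj₁ (_ , lw)  = lw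
  ... | inj₂ (lh′ , _) = clash lh lh′ λ ()

  hub-mate-colour : ∀ {h w} → level h ≡ 1 → mate h ≡ just w → colour h w ≡ just (suc zero)
  hub-mate-colour {h} {w} lh mh =
    let o≡ , c≡ = mate-owns (hasRole w) (mate-above lh mh) (mate-sym mh)
    in trans (colour-sym h w) (trans (colour-owned o≡) (cong just c≡))

  -- Every edge is satisfied or isolated

  satisfied-by-owner : ∀ {u v z} → u ~ v → Ordinary u → Owns u z → z ≢ v →
    (∀ w → colour v w ≢ just (hue u)) → Satisfied H φ u v
  satisfied-by-owner {u} uv ord-u p z≢v free =
    satisfied-at φ uv (colour-owned p) z≢v
      (λ w eq → case colours-ordinary ord-u eq of λ
        { (inj₁ (q , _)) → just-injective (trans (sym q) p)
        ; (inj₂ c≡)      → contradiction (sym c≡) (next≢ (hue u)) })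
      free

  -- With `hue u` equal to `c`, the vertex `v` sees only `next c` and `next (next c)`, while `u`
  -- sees `c` on its owned edge alone. That edge is not `uv`, since otherwise `c` would be
  -- `next (hue v)`.
  satisfied-successor : ∀ {u v z} → u ~ v → Ordinary u → Ordinary v → Owns u z →
    hue v ≡ next (hue u) → Satisfied H φ u v
  satisfied-successor {u} {v} uv ord-u ord-v p hv =
    satisfied-by-owner uv ord-u p
      (λ { refl → contradiction (owned-by-ordinary (owns-role p) (hasRole v) ord-v) ≢next })
      (λ w eq → case colours-ordinary ord-v eq of λ
        { (inj₁ (_ , c≡)) → contradiction (sym (trans c≡ hv)) (next≢ (hue u))
        ; (inj₂ c≡)       → contradiction c≡ ≢next })
    where
    ≢next : hue u ≢ next (hue v)
    ≢next c≡ = contradiction (sym (trans c≡ (cong next hv))) (next²≢ (hue u))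

  Settled : Fin n → Fin n → Set
  Settled u v = Satisfied H φ u v ⊎ (IsolatedEdge H u v × colour u v ≡ nothing)

  -- The root sees only colour 0, so a colour 1 or 2 occurring once at `v` is enough: the matching
  -- edge of a hub, or the edge that an unmatched `v` owns towards level 2.
  settled-root : ∀ {u v} → u ~ v → level u ≡ 0 → level v ≡ 1 → Settled u v
  settled-root {u} {v} uv lu lv with kind v
  ... | isRoot l = clash l lv λ ()
  ... | isHub {w} _ mv = inj₁ (Satisfied-sym φ (satisfied-at φ (edge-sym H uv) (hub-mate-colour lv mv)
          (λ { refl → clash lu (mate-above lv mv) λ () })
          (λ z eq → case colours-hub lv mv eq of λ
            { (inj₁ (_ , ())) ; (inj₂ (inj₁ (z≡ , _))) → z≡ ; (inj₂ (inj₂ ())) })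
          (λ z eq → case colours-root lu eq of λ ())))
  ... | isOrdinary (inj₂ (_ , l)) = clash l lv λ ()
  ... | isOrdinary ord@(inj₁ (_ , free)) with ordinary-owns (hasRole v) ord
  ...   | inj₁ (z , p) = inj₁ (Satisfied-sym φ (satisfied-by-owner (edge-sym H uv) ord p
            (λ { refl → hue≢0 (owned-by-root (owns-role p) lu) })
            (λ w eq → hue≢0 (colours-root lu eq))))
    where
    hue≢0 : hue v ≢ zero
    hue≢0 h≡ = case trans (sym h≡) (free-hue (hasRole v) lv free) of λ ()
  -- Without a neighbour on level 2, `v` is pendant at the root. The choice of the root then makes
  -- `uv` a whole component, and neither end owns it.
  ...   | inj₂ (_ , none , own≡) = inj₂ (isolated , uncoloured)
    where
    u-root : root u ≡ u
    u-root = sym (level-zero lu)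
    only-u : ∀ z → v ~ z → z ≡ u
    only-u z vz with level-adjacent vz
    ... | inj₁ lz = contradiction (trans lz (cong suc lv)) (none z vz)
    ... | inj₂ lz = trans (level-zero (suc-injective (trans (sym lz) lv)))
                      (trans (sym (root-edge vz)) (trans (sym (root-edge uv)) u-root))
    isolated : IsolatedEdge H u v
    isolated = subst (NoPendantNeighbour H) u-root (root-noPendant u) v uv only-u
    uncoloured : colour u v ≡ nothing
    uncoloured with colour u v in eq
    ... | nothing = refl
    ... | just _ with colour-cases {u} {v} eq
    ...   | inj₁ (p , _) = contradiction lu (owner-level (owns-role p))
    ...   | inj₂ (p , _) = case trans (sym own≡) p of λ ()

  -- A matched `v` sees only colours 1 and 2, so colour 0 on the hub's edge to the root works. An
  -- unmatched `v` sees only 2 and 0, so colour 1 on the matching edge works.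
  settled-hub : ∀ {u v w} → u ~ v → level u ≡ 1 → mate u ≡ just w → level v ≡ 2 → Satisfied H φ u v
  settled-hub {u} {v} {w} uv lu mu lv = by-hue (tone (hasRole v) lv) refl
    where
    ord-v : Ordinary v
    ord-v = inj₂ (0 , lv)
    by-hue : ∀ {c} → Tone 0 v c → hue v ≡ c → Satisfied H φ u v
    by-hue (plain _) hv = satisfied-at φ uv (hub-root-colour lu mu)
      (λ { refl → clash (level-root u) lv λ () })
      (λ z eq → case colours-hub lu mu eq of λ
        { (inj₁ (z≡ , _)) → z≡ ; (inj₂ (inj₁ (_ , ()))) ; (inj₂ (inj₂ ())) })
      (λ z eq → case colours-ordinary ord-v eq of λ
        { (inj₁ (_ , c≡)) → case trans c≡ hv of λ ()
        ; (inj₂ c≡)       → case trans c≡ (cong next hv) of λ () })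
    by-hue (primed free) hv = satisfied-at φ uv (hub-mate-colour lu mu)
      (λ { refl → mate-just (mate-sym mu) free })
      (λ z eq → case colours-hub lu mu eq of λ
        { (inj₁ (_ , ())) ; (inj₂ (inj₁ (z≡ , _))) → z≡ ; (inj₂ (inj₂ ())) })
      (λ z eq → case colours-ordinary ord-v eq of λ
        { (inj₁ (_ , c≡)) → case trans c≡ hv of λ ()
        ; (inj₂ c≡)       → case trans c≡ (cong next hv) of λ () })

  settled-upward : ∀ {u v} → u ~ v → level v ≡ suc (level u) → Settled u v
  settled-upward {u} {v} uv lv with kind u
  ... | isRoot lu = settled-root uv lu (trans lv (cong suc lu))
  ... | isHub lu mu = inj₁ (settled-hub uv lu mu (trans lv (cong suc lu)))
  -- By maximality `v` is matched and has hue 1, and `u` has hue 2, so the edge that `v` owns is the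
  -- witness.
  ... | isOrdinary ord@(inj₁ (lu , free)) =
    let lv₂ = trans lv (cong suc lu)
        o≡ , c≡ = mate-owns (hasRole v) lv₂ (proj₂ (matched-neighbour uv lu lv₂ free))
    in inj₁ (Satisfied-sym φ (satisfied-successor (edge-sym H uv) (inj₂ (0 , lv₂)) ord o≡
         (trans (free-hue (hasRole u) lu free) (sym (cong next c≡)))))
  ... | isOrdinary ord@(inj₂ (k , lu)) =
    let lv₃ = trans lv (cong suc lu)
        ord-v = inj₂ (suc k , lv₃)
    in inj₁ (case tone-step uv lu (tone (hasRole u) lu) (tone (hasRole v) lv₃) of λ
         { (inj₁ hv) → satisfied-successor uv ord ord-v (proj₂ (above-owns lu)) hv
         ; (inj₂ hu) → Satisfied-sym φ
             (satisfied-successor (edge-sym H uv) ord-v ord (proj₂ (above-owns lv₃)) hu) })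

  settled : ∀ u v → u ~ v → Settled u v
  settled u v uv with level-adjacent uv
  ... | inj₁ lv = settled-upward uv lv
  ... | inj₂ lu with settled-upward (edge-sym H uv) lu
  ...   | inj₁ sat = inj₁ (Satisfied-sym φ sat)
  ...   | inj₂ ((only-v , only-u) , none) = inj₂ ((only-u , only-v) , trans (colour-sym u v) none)

bipartite-colouring : ∀ {n} (H : SimpleGraph n) (side : Fin n → Bool) →
  (∀ u v → IsEdge H u v → side u ≢ side v) →
  ∃[ φ ] SatisfiedOrIsolated H φ
bipartite-colouring H side proper = φ , settled
  where
  L : Levelling H
  L = Distances.levelling H side proper
  open Owners L (proj₁ (Matchings.maximalMatching L)) (proj₂ (Matchings.maximalMatching L))

-- Enlarging the bipartite graph by edges of the old matching

module Decided {n : ℕ} {R : Fin n → Fin n → Set} (R? : ∀ x y → Dec (R x y))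
  (R-sym : ∀ {x y} → R x y → R y x) where

  decided : Fin n → Fin n → Bool
  decided x y = does (R? x y)

  decided-sym : ∀ x y → decided x y ≡ decided y x
  decided-sym x y = does-⇔ (mk⇔ R-sym R-sym) (R? x y) (R? y x)

  decidedGraph : (∀ {x} → ¬ R x x) → SimpleGraph n
  decidedGraph R-irrefl = record
    { adj = decided ; adj-sym = decided-sym ; irrefl = λ u → dec-false (R? u u) R-irrefl }

module AddEdge {n : ℕ} (H : SimpleGraph n) {a b : Fin n} (a≢b : a ≢ b) where

  Edge⁺ : Fin n → Fin n → Set
  Edge⁺ x y = IsEdge H x y ⊎ SameEdge H x y a b

  edge⁺? : ∀ x y → Dec (Edge⁺ x y)
  edge⁺? x y = edge? H x y ⊎-dec (((x ≟ a) ×-dec (y ≟ b)) ⊎-dec ((x ≟ b) ×-dec (y ≟ a)))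

  edge⁺-sym : ∀ {x y} → Edge⁺ x y → Edge⁺ y x
  edge⁺-sym (inj₁ e)                = inj₁ (edge-sym H e)
  edge⁺-sym (inj₂ (inj₁ (x≡ , y≡))) = inj₂ (inj₂ (y≡ , x≡))
  edge⁺-sym (inj₂ (inj₂ (x≡ , y≡))) = inj₂ (inj₁ (y≡ , x≡))

  edge⁺-irrefl : ∀ {x} → ¬ Edge⁺ x x
  edge⁺-irrefl (inj₁ e)                = edge-irrefl H e refl
  edge⁺-irrefl (inj₂ (inj₁ (x≡ , y≡))) = a≢b (trans (sym x≡) y≡)
  edge⁺-irrefl (inj₂ (inj₂ (x≡ , y≡))) = a≢b (trans (sym y≡) x≡)

  graph : SimpleGraph n
  graph = Decided.decidedGraph edge⁺? edge⁺-sym edge⁺-irrefl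

  cases : ∀ {x y} → IsEdge graph x y → Edge⁺ x y
  cases {x} {y} = does⇒ (edge⁺? x y)

  old : ∀ {x y} → IsEdge H x y → IsEdge graph x y
  old {x} {y} e = dec-true (edge⁺? x y) (inj₁ e)

  new : IsEdge graph a b
  new = dec-true (edge⁺? a b) (inj₂ (inj₁ (refl , refl)))

InIsolatedEdge : ∀ {n} → SimpleGraph n → Fin n → Set
InIsolatedEdge H u = ∃[ v ] IsEdge H u v × IsolatedEdge H u v

-- By `upper` only edges of `M` are added. In the induction these are uncoloured, hence free to take
-- the new colours.
record BipartiteExtension {n : ℕ} (B : SimpleGraph n) (M : Fin n → Fin n → Set) : Set where
  field
    graph  : SimpleGraph n
    side   : Fin n → Bool
    proper : ∀ u v → IsEdge graph u v → side u ≢ side v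
    lower  : ∀ {u v} → IsEdge B u v → IsEdge graph u v
    upper  : ∀ {u v} → IsEdge graph u v → IsEdge B u v ⊎ M u v

-- Only the end `b` is mentioned: with `M` symmetric and all ordered pairs swept, both ends are
-- covered.
Absorbed : ∀ {n} {B : SimpleGraph n} {M} → Fin n → Fin n → BipartiteExtension B M → Set
Absorbed {M = M} a b S = M a b → IsEdge graph a b ⊎ ¬ InIsolatedEdge graph b
  where open BipartiteExtension S

module Extension {n : ℕ} (B : SimpleGraph n) (side₀ : Fin n → Bool)
  (proper₀ : ∀ u v → IsEdge B u v → side₀ u ≢ side₀ v)
  {M : Fin n → Fin n → Set} (M? : ∀ u v → Dec (M u v))
  (M-sym : ∀ {u v} → M u v → M v u) (M-irrefl : ∀ {u v} → M u v → u ≢ v) where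

  open BipartiteExtension

  -- The component {b, d} is a single edge not containing a, so its two sides can be exchanged
  -- to make room for the edge ab.
  module Join (S : BipartiteExtension B M) {a b d : Fin n} (ab : M a b)
    (¬ab : ¬ IsEdge (graph S) a b) (bd : IsEdge (graph S) b d)
    (isolated : IsolatedEdge (graph S) b d) where

    H : SimpleGraph n
    H = graph S
    open AddEdge H (M-irrefl ab) renaming (graph to H⁺)

    a≢d : a ≢ d
    a≢d refl = ¬ab (edge-sym H bd)

    flip : Fin n → Bool
    flip x with x ≟ b | x ≟ d
    ... | yes _ | _     = not (side S x)
    ... | no _  | yes _ = not (side S x)
    ... | no _  | no _  = side S x

    flip-b : flip b ≡ not (side S b)
    flip-b with b ≟ b | b ≟ d
    ... | yes _ | _ = refl
    ... | no ¬p | _ = contradiction refl ¬p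

    flip-d : flip d ≡ not (side S d)
    flip-d with d ≟ b | d ≟ d
    ... | yes _ | _     = refl
    ... | no _  | yes _ = refl
    ... | no _  | no ¬p = contradiction refl ¬p

    flip-other : ∀ {x} → x ≢ b → x ≢ d → flip x ≡ side S x
    flip-other {x} x≢b x≢d with x ≟ b | x ≟ d
    ... | yes p | _     = contradiction p x≢b
    ... | no _  | yes p = contradiction p x≢d
    ... | no _  | no _  = refl

    flip-bd : flip b ≢ flip d
    flip-bd eq = proper S b d bd (Bool.not-injective (trans (sym flip-b) (trans eq flip-d)))

    flip-proper : ∀ x y → IsEdge H x y → flip x ≢ flip y
    flip-proper x y xy eq with x ≟ b | x ≟ d
    ... | yes refl | _ = flip-bd (trans (trans flip-b eq) (cong flip (proj₁ isolated y xy)))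
    ... | no _ | yes refl =
      flip-bd (sym (trans (trans flip-d eq) (cong flip (proj₂ isolated y xy))))
    ... | no x≢b | no x≢d = proper S x y xy (trans eq (flip-other
        (λ { refl → x≢d (proj₁ isolated x (edge-sym H xy)) })
        (λ { refl → x≢b (proj₂ isolated x (edge-sym H xy)) })))

    recolouring : Σ (Fin n → Bool) λ τ → (∀ x y → IsEdge H x y → τ x ≢ τ y) × τ a ≢ τ b
    recolouring with side S a Bool.≟ side S b
    ... | no a≢b = side S , proper S , a≢b
    ... | yes a≡b = flip , flip-proper , λ eq →
      not-¬ refl (trans (sym a≡b) (trans (sym (flip-other (M-irrefl ab) a≢d)) (trans eq flip-b)))

    joined : BipartiteExtension B M
    joined = record
      { graph  = H⁺
      ; side   = proj₁ recolouring
      ; proper = λ x y e → case cases e of λ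
          { (inj₁ xy)                   → proj₁ (proj₂ recolouring) x y xy
          ; (inj₂ (inj₁ (refl , refl))) → proj₂ (proj₂ recolouring)
          ; (inj₂ (inj₂ (refl , refl))) → proj₂ (proj₂ recolouring) ∘ sym }
      ; lower  = old ∘ lower S
      ; upper  = λ e → case cases e of λ
          { (inj₁ xy)                   → upper S xy
          ; (inj₂ (inj₁ (refl , refl))) → inj₂ ab
          ; (inj₂ (inj₂ (refl , refl))) → inj₂ (M-sym ab) } }

    -- The new edge is not isolated, because `b` keeps its neighbour `d`. Joining thus creates no
    -- isolated edge, and earlier pairs stay `Absorbed`.
    isolated⁻ : ∀ {x} → InIsolatedEdge H⁺ x → InIsolatedEdge H x
    isolated⁻ (y , e , only-y , only-x) with cases e
    ... | inj₁ xy = y , xy , (λ w → only-y w ∘ old) , (λ w → only-x w ∘ old)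
    ... | inj₂ (inj₁ (refl , refl)) = contradiction (sym (only-x d (old bd))) a≢d
    ... | inj₂ (inj₂ (refl , refl)) = contradiction (sym (only-y d (old bd))) a≢d

  maximalExtension : ∃[ S ] (∀ a b → Absorbed a b S)
  maximalExtension = saturate Absorbed step start
    where
    start : BipartiteExtension B M
    start = record { graph = B ; side = side₀ ; proper = proper₀ ; lower = id ; upper = inj₁ }
    step : ∀ a b S → ∃[ T ] (∀ c d → Absorbed c d S → Absorbed c d T) × Absorbed a b T
    step a b S with M? a b | edge? (graph S) a b
                  | any? (λ v → edge? (graph S) b v ×-dec isolatedEdge? (graph S) b v)
    ... | no ¬m | _ | _ = S , (λ _ _ → id) , λ m → contradiction m ¬m
    ... | yes _ | yes e | _ = S , (λ _ _ → id) , λ _ → inj₁ e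
    ... | yes _ | no _ | no ¬iso = S , (λ _ _ → id) , λ _ → inj₂ ¬iso
    ... | yes m | no ¬e | yes (_ , bd , iso) =
      joined , (λ c d absorbed cd → Sum.map old (_∘ isolated⁻) (absorbed cd)) , λ _ → inj₁ new
      where
      open Join S m ¬e bd iso
      open AddEdge (graph S) (M-irrefl m)

-- Combining the colourings of two subgraphs

-- Uniqueness concerns only edges coloured `ι β`. These all come from `H`, so the further edges of
-- `G` at `u` or `v` do no harm.
transfer : ∀ {n k l} {G H : SimpleGraph n} {φ : PartialEdgeColouring G k} {ψ : PartialEdgeColouring H l}
  (ι : Fin l → Fin k) → (∀ {x y} → IsEdge H x y → IsEdge G x y) →
  (∀ {x y β} → col ψ x y ≡ just β → col φ x y ≡ just (ι β)) →
  (∀ {x y β} → col φ x y ≡ just (ι β) → col ψ x y ≡ just β) →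
  ∀ {u v} → Satisfied H ψ u v → Satisfied G φ u v
transfer {ψ = ψ} ι H⊆G to from (β , x , y , (xy , at) , ≢uv , ψxy , uniq) =
  ι β , x , y , (H⊆G xy , at) , ≢uv , to ψxy ,
  λ a b (_ , at′) ≢xy φab →
    uniq a b (col-edge ψ a b β (from φab) , at′) ≢xy (from φab)

Conclusion : ∀ {n} → SimpleGraph n → ℕ → Set
Conclusion {n} G k =
  Σ (PartialEdgeColouring G k) λ φ →
  Σ (Fin n → Fin n → Bool) λ M →
  IsUncolouredMatching G φ M ×
  (∀ u v → IsEdge G u v → M u v ≡ false → Satisfied G φ u v)

module Overlay {m k : ℕ} where

  overlay : Maybe (Fin m) → Maybe (Fin k) → Maybe (Fin (m + k))
  overlay (just β) _        = just (β ↑ˡ k)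
  overlay nothing  (just γ) = just (m ↑ʳ γ)
  overlay nothing  nothing  = nothing

  ↑ˡ≢↑ʳ : ∀ {β : Fin m} {γ : Fin k} → β ↑ˡ k ≢ m ↑ʳ γ
  ↑ˡ≢↑ʳ {β} {γ} eq =
    case trans (sym (splitAt-↑ˡ m β k)) (trans (cong (splitAt m) eq) (splitAt-↑ʳ m k γ)) of λ ()

  overlay-left : ∀ {p q β} → p ≡ just β → overlay p q ≡ just (β ↑ˡ k)
  overlay-left refl = refl

  overlay-right : ∀ {p q γ} → p ≡ nothing → q ≡ just γ → overlay p q ≡ just (m ↑ʳ γ)
  overlay-right refl refl = refl

  overlay-left⁻ : ∀ p q {β} → overlay p q ≡ just (β ↑ˡ k) → p ≡ just β
  overlay-left⁻ (just β) _        eq = cong just (↑ˡ-injective k _ _ (just-injective eq))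
  overlay-left⁻ nothing  (just γ) eq = contradiction (sym (just-injective eq)) ↑ˡ≢↑ʳ

  overlay-right⁻ : ∀ p q {γ} → overlay p q ≡ just (m ↑ʳ γ) → q ≡ just γ
  overlay-right⁻ (just β) _        eq = contradiction (just-injective eq) ↑ˡ≢↑ʳ
  overlay-right⁻ nothing  (just γ) eq = cong just (↑ʳ-injective m _ _ (just-injective eq))

  overlay-just⁻ : ∀ p q {δ} → overlay p q ≡ just δ → (∃[ β ] p ≡ just β) ⊎ (∃[ γ ] q ≡ just γ)
  overlay-just⁻ (just β) _        _ = inj₁ (β , refl)
  overlay-just⁻ nothing  (just γ) _ = inj₂ (γ , refl)

  overlay-nothing : ∀ {p q} → p ≡ nothing → q ≡ nothing → overlay p q ≡ nothing
  overlay-nothing refl refl = refl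

module Induct {n k : ℕ} (G : SimpleGraph n) (half : Fin n → Fin 2) where

  Inner Cross : Fin n → Fin n → Set
  Inner x y = IsEdge G x y × half x ≡ half y
  Cross x y = IsEdge G x y × half x ≢ half y

  inner? : ∀ x y → Dec (Inner x y)
  inner? x y = edge? G x y ×-dec (half x ≟ half y)

  cross? : ∀ x y → Dec (Cross x y)
  cross? x y = edge? G x y ×-dec ¬? (half x ≟ half y)

  inner cross : SimpleGraph n
  inner = Decided.decidedGraph inner? (λ (e , p) → edge-sym G e , sym p)
            (λ (e , _) → edge-irrefl G e refl)
  cross = Decided.decidedGraph cross? (λ (e , p) → edge-sym G e , p ∘ sym)
            (λ (e , _) → edge-irrefl G e refl)

  inner⇒ : ∀ {x y} → IsEdge inner x y → Inner x y
  inner⇒ {x} {y} = does⇒ (inner? x y)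

  cross⇒ : ∀ {x y} → IsEdge cross x y → Cross x y
  cross⇒ {x} {y} = does⇒ (cross? x y)

  side : Fin n → Bool
  side x = does (half x ≟ zero)

  cross-proper : ∀ u v → IsEdge cross u v → side u ≢ side v
  cross-proper u v e = proj₂ (cross⇒ e) ∘ side-injective (half u) (half v)
    where
    side-injective : ∀ (i j : Fin 2) → does (i ≟ zero) ≡ does (j ≟ zero) → i ≡ j
    side-injective zero       zero       _ = refl
    side-injective (suc zero) (suc zero) _ = refl

  module Combine (φ₀ : PartialEdgeColouring inner k) (M₀ : Fin n → Fin n → Bool)
    (M₀-matching : IsUncolouredMatching inner φ₀ M₀)
    (satisfied₀ : ∀ u v → IsEdge inner u v → M₀ u v ≡ false → Satisfied inner φ₀ u v)
    (S : BipartiteExtension cross (λ u v → M₀ u v ≡ true)) (absorbed : ∀ a b → Absorbed a b S)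
    (ψ : PartialEdgeColouring (BipartiteExtension.graph S) 3)
    (ψ-settled : SatisfiedOrIsolated (BipartiteExtension.graph S) ψ) where

    open BipartiteExtension S using (lower; upper) renaming (graph to H)

    M₀-sym : ∀ {u v} → M₀ u v ≡ true → M₀ v u ≡ true
    M₀-sym {u} {v} = trans (proj₁ M₀-matching v u)

    M₀-edge : ∀ {u v} → M₀ u v ≡ true → IsEdge inner u v
    M₀-edge {u} {v} m = proj₁ (proj₁ (proj₂ M₀-matching) u v m)

    H⊆G : ∀ {x y} → IsEdge H x y → IsEdge G x y
    H⊆G e with upper e
    ... | inj₁ b = proj₁ (cross⇒ b)
    ... | inj₂ m = proj₁ (inner⇒ (M₀-edge m))

    -- `φ₀` colours neither cross edges nor edges of `M₀`. The two colourings therefore never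
    -- compete for an edge, and giving `ψ` precedence in `overlay` hides no colour of `φ₀`.
    H-uncoloured₀ : ∀ {x y} → IsEdge H x y → col φ₀ x y ≡ nothing
    H-uncoloured₀ {x} {y} e with upper e
    ... | inj₂ m = proj₂ (proj₁ (proj₂ M₀-matching) x y m)
    ... | inj₁ b with col φ₀ x y in eq
    ...   | nothing = refl
    ...   | just β  = contradiction (proj₂ (inner⇒ (col-edge φ₀ x y β eq))) (proj₂ (cross⇒ b))

    uncoloured-ψ : ∀ {x y} → ¬ IsEdge H x y → col ψ x y ≡ nothing
    uncoloured-ψ {x} {y} ¬e with col ψ x y in eq
    ... | nothing = refl
    ... | just β  = contradiction (col-edge ψ x y β eq) ¬e

    open Overlay {3} {k}

    φ : PartialEdgeColouring G (3 + k)
    φ = record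
      { col      = λ x y → overlay (col ψ x y) (col φ₀ x y)
      ; col-sym  = λ x y → cong₂ overlay (col-sym ψ x y) (col-sym φ₀ x y)
      ; col-edge = λ x y δ eq → case overlay-just⁻ (col ψ x y) (col φ₀ x y) eq of λ
          { (inj₁ (β , p)) → H⊆G (col-edge ψ x y β p)
          ; (inj₂ (γ , q)) → proj₁ (inner⇒ (col-edge φ₀ x y γ q)) } }

    transfer-ψ : ∀ {u v} → Satisfied H ψ u v → Satisfied G φ u v
    transfer-ψ = transfer {φ = φ} {ψ = ψ} (_↑ˡ k) H⊆G overlay-left
      (λ {x} {y} → overlay-left⁻ (col ψ x y) (col φ₀ x y))

    transfer-φ₀ : ∀ {u v} → Satisfied inner φ₀ u v → Satisfied G φ u v
    transfer-φ₀ = transfer {φ = φ} {ψ = φ₀} (3 ↑ʳ_) (proj₁ ∘ inner⇒)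
      (λ {x} {y} q → overlay-right
        (uncoloured-ψ λ e → case trans (sym q) (H-uncoloured₀ e) of λ ()) q)
      (λ {x} {y} → overlay-right⁻ (col ψ x y) (col φ₀ x y))

    Leftover : Fin n → Fin n → Set
    Leftover u v = (M₀ u v ≡ true × ¬ IsEdge H u v) ⊎
               (IsEdge H u v × IsolatedEdge H u v × col ψ u v ≡ nothing)

    leftover? : ∀ u v → Dec (Leftover u v)
    leftover? u v = ((M₀ u v Bool.≟ true) ×-dec ¬? (edge? H u v)) ⊎-dec
      (edge? H u v ×-dec isolatedEdge? H u v ×-dec Maybe.≡-dec _≟_ (col ψ u v) nothing)

    leftover-sym : ∀ {u v} → Leftover u v → Leftover v u
    leftover-sym (inj₁ (m , ¬e)) = inj₁ (M₀-sym m , ¬e ∘ edge-sym H)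
    leftover-sym {u} {v} (inj₂ (e , (p , q) , none)) =
      inj₂ (edge-sym H e , (q , p) , trans (col-sym ψ v u) none)

    open Decided leftover? leftover-sym renaming (decided to M; decided-sym to M-sym)

    leftover-uncoloured : ∀ {u v} → Leftover u v → IsEdge G u v × col φ u v ≡ nothing
    leftover-uncoloured {u} {v} (inj₁ (m , ¬e)) =
      proj₁ (inner⇒ (M₀-edge m)) ,
      overlay-nothing (uncoloured-ψ ¬e) (proj₂ (proj₁ (proj₂ M₀-matching) u v m))
    leftover-uncoloured (inj₂ (e , _ , none)) = H⊆G e , overlay-nothing none (H-uncoloured₀ e)

    -- This is what the enlargement of the cross graph was for: by `absorbed`, no end of an edge of
    -- `M₀` outside `H` lies on an isolated edge of `H`.
    apart : ∀ {u v x y} → M₀ u v ≡ true → ¬ IsEdge H u v → IsEdge H x y → IsolatedEdge H x y →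
      ¬ (x ≡ u ⊎ x ≡ v ⊎ y ≡ u ⊎ y ≡ v)
    apart {u} {v} m ¬e xy (only-y , only-x) = λ
      { (inj₁ refl)               → not-isolated (M₀-sym m) (¬e ∘ edge-sym H) (_ , xy , only-y , only-x)
      ; (inj₂ (inj₁ refl))        → not-isolated m ¬e (_ , xy , only-y , only-x)
      ; (inj₂ (inj₂ (inj₁ refl))) →
          not-isolated (M₀-sym m) (¬e ∘ edge-sym H) (_ , edge-sym H xy , only-x , only-y)
      ; (inj₂ (inj₂ (inj₂ refl))) → not-isolated m ¬e (_ , edge-sym H xy , only-x , only-y) }
      where
      not-isolated : ∀ {a b} → M₀ a b ≡ true → ¬ IsEdge H a b → ¬ InIsolatedEdge H b
      not-isolated {a} {b} m ¬e iso with absorbed a b m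
      ... | inj₁ e    = ¬e e
      ... | inj₂ ¬iso = ¬iso iso

    -- Two old matching edges are handled by the induction hypothesis, a mixed pair by `apart`; two
    -- isolated edges of `H` that meet are the same component.
    leftover-matching : ∀ {u v x y} → Leftover u v → Leftover x y →
      (x ≡ u ⊎ x ≡ v ⊎ y ≡ u ⊎ y ≡ v) → SameEdge G x y u v
    leftover-matching (inj₁ (m , _)) (inj₁ (m′ , _)) at = proj₂ (proj₂ M₀-matching) _ _ _ _ m m′ at
    leftover-matching (inj₁ (m , ¬e)) (inj₂ (xy , iso , _)) at = contradiction at (apart m ¬e xy iso)
    leftover-matching (inj₂ (uv , iso , _)) (inj₁ (m , ¬e)) at = contradiction (swap at) (apart m ¬e uv iso)
      where
      swap : ∀ {u v x y : Fin n} → (x ≡ u ⊎ x ≡ v ⊎ y ≡ u ⊎ y ≡ v) → (u ≡ x ⊎ u ≡ y ⊎ v ≡ x ⊎ v ≡ y)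
      swap (inj₁ p)               = inj₁ (sym p)
      swap (inj₂ (inj₁ p))        = inj₂ (inj₂ (inj₁ (sym p)))
      swap (inj₂ (inj₂ (inj₁ p))) = inj₂ (inj₁ (sym p))
      swap (inj₂ (inj₂ (inj₂ p))) = inj₂ (inj₂ (inj₂ (sym p)))
    leftover-matching (inj₂ (_ , (only-v , only-u) , _)) (inj₂ (xy , _)) = λ
      { (inj₁ refl)               → inj₁ (refl , only-v _ xy)
      ; (inj₂ (inj₁ refl))        → inj₂ (refl , only-u _ xy)
      ; (inj₂ (inj₂ (inj₁ refl))) → inj₂ (only-v _ (edge-sym H xy) , refl)
      ; (inj₂ (inj₂ (inj₂ refl))) → inj₁ (only-u _ (edge-sym H xy) , refl) }

    -- Edges of `H` are left to `ψ`. By `lower` an edge outside `H` lies inside a half, and outside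
    -- `M₀` it is satisfied by `φ₀`.
    satisfied : ∀ u v → IsEdge G u v → ¬ Leftover u v → Satisfied G φ u v
    satisfied u v uv ¬leftover with edge? H u v
    ... | yes e with ψ-settled u v e
    ...   | inj₁ sat          = transfer-ψ sat
    ...   | inj₂ (iso , none) = contradiction (inj₂ (e , iso , none)) ¬leftover
    satisfied u v uv ¬leftover | no ¬e with half u ≟ half v | M₀ u v Bool.≟ true
    ... | no ¬p | _     = contradiction (lower (dec-true (cross? u v) (uv , ¬p))) ¬e
    ... | yes _ | yes m = contradiction (inj₁ (m , ¬e)) ¬leftover
    ... | yes p | no ¬m = transfer-φ₀ (satisfied₀ u v (dec-true (inner? u v) (uv , p)) (¬-not ¬m))

    conclusion : Conclusion G (3 + k)
    conclusion = φ , M ,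
      ( M-sym
      , (λ u v m → leftover-uncoloured (does⇒ (leftover? u v) m))
      , (λ u v x y m m′ → leftover-matching (does⇒ (leftover? u v) m) (does⇒ (leftover? x y) m′)) ) ,
      λ u v uv m≡false → satisfied u v uv λ l →
        case trans (sym m≡false) (dec-true (leftover? u v) l) of λ ()

  conclusion : Conclusion inner k → Conclusion G (3 + k)
  conclusion (φ₀ , M₀ , matching@(M₀-sym , M₀-uncoloured , _) , satisfied₀) =
    Combine.conclusion φ₀ M₀ matching satisfied₀ (proj₁ extension) (proj₂ extension)
      (proj₁ coloured) (proj₂ coloured)
    where
    extension : ∃[ S ] (∀ a b → Absorbed a b S)
    extension = Extension.maximalExtension cross side cross-proper (λ u v → M₀ u v Bool.≟ true)
      (λ {u} {v} → trans (M₀-sym v u)) (λ {u} {v} m → edge-irrefl inner (proj₁ (M₀-uncoloured u v m)))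
    open BipartiteExtension (proj₁ extension) using (graph; proper) renaming (side to sideᴴ)
    coloured : ∃[ ψ ] SatisfiedOrIsolated graph ψ
    coloured = bipartite-colouring graph sideᴴ proper

-- Induction on the number of binary digits

-- The palette is written `k * 3` so that `suc k * 3` computes to `3 + k * 3`, the palette of the
-- combined colouring.
binary-colouring : ∀ k {n} (G : SimpleGraph n) (c : Fin n → Fin (2 ^ k)) →
  ProperColouring G (2 ^ k) c → Conclusion G (k * 3)
-- A proper colouring with `2 ^ 0` colours leaves no edges, so nothing has to be coloured.
binary-colouring zero G c c-proper =
  record { col = λ _ _ → nothing ; col-sym = λ _ _ → refl ; col-edge = λ _ _ _ () } ,
  (λ _ _ → false) , ((λ _ _ → refl) , (λ _ _ ()) , (λ _ _ _ _ ())) ,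
  λ u v uv _ → contradiction (unique (c u) (c v)) (c-proper u v uv)
  where
  unique : (i j : Fin 1) → i ≡ j
  unique zero zero = refl
binary-colouring (suc k) {n} G c c-proper =
  conclusion (binary-colouring k inner rest rest-proper)
  where
  digits : Fin n → Fin 2 × Fin (2 ^ k)
  digits x = remQuot (2 ^ k) (c x)
  rest : Fin n → Fin (2 ^ k)
  rest = proj₂ ∘ digits
  open Induct {k = k * 3} G (proj₁ ∘ digits)
  -- Ends of an inner edge share the first digit, so equal remaining digits would give equal
  -- colours.
  rest-proper : ProperColouring inner (2 ^ k) rest
  rest-proper u v uv eq = c-proper u v (proj₁ (inner⇒ uv)) (begin
    c u                        ≡⟨ combine-remQuot {2} (2 ^ k) (c u) ⟨
    uncurry combine (digits u) ≡⟨ cong₂ combine (proj₂ (inner⇒ uv)) eq ⟩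
    uncurry combine (digits v) ≡⟨ combine-remQuot {2} (2 ^ k) (c v) ⟩
    c v                        ∎)
    where open ≡-Reasoning

-- Induction on the value of the logarithm: replacing `α` by `⌈ α /2⌉` lowers it by one, and `α` is
-- at most twice that half.
≤2^⌈log₂⌉ : ∀ k α → ⌈log₂ α ⌉ ≡ k → α ≤ 2 ^ k
≤2^⌈log₂⌉ zero zero          _ = z≤n
≤2^⌈log₂⌉ zero (suc zero)    _ = s≤s z≤n
≤2^⌈log₂⌉ zero (suc (suc α)) log≡0 =
  contradiction (subst (1 ≤_) log≡0 (⌈log₂⌉-mono-≤ {2} {suc (suc α)} (s≤s (s≤s z≤n)))) λ ()
≤2^⌈log₂⌉ (suc k) α log≡ = begin
  α                     ≡⟨ ℕ.⌊n/2⌋+⌈n/2⌉≡n α ⟨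
  ⌊ α /2⌋ + ⌈ α /2⌉     ≤⟨ ℕ.+-mono-≤ (≤-trans (ℕ.⌊n/2⌋≤⌈n/2⌉ α) half≤) half≤ ⟩
  2 ^ k + 2 ^ k         ≡⟨ cong (2 ^ k +_) (ℕ.+-identityʳ (2 ^ k)) ⟨
  2 ^ suc k             ∎
  where
  open ℕ.≤-Reasoning
  half≤ : ⌈ α /2⌉ ≤ 2 ^ k
  half≤ = ≤2^⌈log₂⌉ k ⌈ α /2⌉ (trans (⌈log₂⌈n/2⌉⌉≡⌈log₂n⌉∸1 α) (cong (_∸ 1) log≡))

theorem11 : (α : ℕ) → α ≥ 1 → (n : ℕ) → (G : SimpleGraph n) →
    ChromaticAtMost G α →
    Σ (PartialEdgeColouring G (3 * ⌈log₂ α ⌉)) λ φ →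
    Σ (Fin n → Fin n → Bool) λ M →
    IsUncolouredMatching G φ M ×
    (∀ u v → IsEdge G u v → M u v ≡ false → Satisfied G φ u v)
theorem11 α _ n G (c , c-proper) =
  subst (Conclusion G) (ℕ.*-comm ⌈log₂ α ⌉ 3)
    (binary-colouring ⌈log₂ α ⌉ G (λ x → inject≤ (c x) α≤)
      (λ u v uv eq → c-proper u v uv (inject≤-injective α≤ α≤ (c u) (c v) eq)))
  where
  α≤ : α ≤ 2 ^ ⌈log₂ α ⌉
  α≤ = ≤2^⌈log₂⌉ ⌈log₂ α ⌉ α refl
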